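{- Let $\Delta$ be a pure quasi-forest of dimension $d-1$ with $f$-vector $(f_0,f_1,\ldots,f_{d-1})$. Then $(f_0,\ldots,f_{d-1})$ is unimodal, i.e., there is $j$ with $f_0\le f_1\le\cdots\le f_j\ge f_{j+1}\ge\cdots\ge f_{d-1}$.
   Context: A simplicial complex $\Delta$ on $[n]$ is a collection of subsets of $[n]$ containing all singletons and closed under taking subsets; $\dim\Delta=d-1$ where $d$ is the maximal face size; facets are maximal faces; $\Delta$ is pure if all facets have the same cardinality; $f_i$ is the number of faces with $i+1$ elements. For facets $F_{i_1},\ldots,F_{i_q}$, $\langle F_{i_1},\ldots,F_{i_q}\rangle$ is the subcomplex of all faces contained in some $F_{i_j}$. A facet $F$ is a leaf if there is another facet $G\neq F$ with $H\cap F\subset G\cap F$ for all facets $H\neq F$. A quasi-forest is a simplicial complex whose facets admit an ordering $H_1,\ldots,H_m$ such that for each $1<j\le m$, $H_j$ is a leaf of $\langle H_1,\ldots,H_j\rangle$. -}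

module Defs where

open import Data.Fin.Base using (Fin; toℕ; inject₁) renaming (suc to fsuc)
open import Data.Fin.Subset using (Subset; inside; outside; _⊆_; _∩_; ⁅_⁆; ∣_∣)
open import Data.Fin.Subset.Properties using (_⊆?_)
open import Data.List.Base using (List; []; _∷_; _++_; map; filter; length; lookup; take)
open import Data.List.Membership.Propositional using (_∈_)
open import Data.List.Relation.Unary.Any as Any using (Any; any?)
open import Data.List.Relation.Unary.Unique.Propositional using (Unique)
open import Data.Nat.Base using (ℕ; zero; suc; _≤_; _<_)
open import Data.Nat.Properties using (_≟_)
open import Data.Product.Base using (Σ; ∃; _×_; _,_)
open import Data.Vec.Base using ([]; _∷_)
open import Data.Vec.Functional using (Vector)
open import Function.Bundles using (_⇔_)
open import Relation.Binary.PropositionalEquality using (_≡_; _≢_)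
open import Relation.Nullary.Decidable using (_×-dec_)
open import Relation.Unary using (Decidable)

-- A simplicial complex whose vertex set may be a proper subset of Fin n.
-- This generality is needed because ⟨ F₁ , … , F_q ⟩ is such a complex in
-- general.  Decidability of Face holds for any finite collection and makes
-- the faces countable.
record Complex (n : ℕ) : Set₁ where
  field
    Face       : Subset n → Set
    face?      : Decidable Face
    downClosed : ∀ {F G} → Face G → F ⊆ G → Face F

record SimplicialComplex (n : ℕ) : Set₁ where
  field
    complex    : Complex n
  open Complex complex public
  field
    singletons : ∀ (v : Fin n) → Face ⁅ v ⁆

module _ {n : ℕ} where

  open Complex

  HasDimension : Complex n → ℕ → Set
  HasDimension Δ e =
    (∃ λ F → Face Δ F × ∣ F ∣ ≡ suc e) × (∀ F → Face Δ F → ∣ F ∣ ≤ suc e)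

  Facet : Complex n → Subset n → Set
  Facet Δ F = Face Δ F × (∀ G → Face Δ G → F ⊆ G → F ≡ G)

  Pure : Complex n → Set
  Pure Δ = ∀ F G → Facet Δ F → Facet Δ G → ∣ F ∣ ≡ ∣ G ∣

  subcomplex : Complex n → List (Subset n) → Complex n
  subcomplex Δ Fs = record
    { Face       = λ F → Face Δ F × Any (F ⊆_) Fs
    ; face?      = λ F → face? Δ F ×-dec any? (F ⊆?_) Fs
    ; downClosed = λ {F} {G} (g , p) F⊆G →
        downClosed Δ g F⊆G ,
        Any.map {P = G ⊆_} {Q = F ⊆_} (λ G⊆H x∈F → G⊆H (F⊆G x∈F)) p
    }

  Leaf : Complex n → Subset n → Set
  Leaf Δ F =
    Facet Δ F ×
    (∃ λ G → Facet Δ G × G ≢ F × (∀ H → Facet Δ H → H ≢ F → H ∩ F ⊆ G ∩ F))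

  FacetOrdering : Complex n → List (Subset n) → Set
  FacetOrdering Δ Hs = Unique Hs × (∀ F → F ∈ Hs ⇔ Facet Δ F)

  -- Positions are 0-based: lookup Hs j is H_{j+1}, take (suc (toℕ j)) Hs is
  -- H₁, …, H_{j+1}, and 0 < toℕ j excludes the first facet.
  QuasiForest : Complex n → Set
  QuasiForest Δ = ∃ λ Hs → FacetOrdering Δ Hs ×
    (∀ (j : Fin (length Hs)) → 0 < toℕ j →
       Leaf (subcomplex Δ (take (suc (toℕ j)) Hs)) (lookup Hs j))

-- Lists every subset exactly once.
allSubsets : ∀ n → List (Subset n)
allSubsets zero    = [] ∷ []
allSubsets (suc n) =
  map (outside ∷_) (allSubsets n) ++ map (inside ∷_) (allSubsets n)

numFaces : ∀ {n} → Complex n → ℕ → ℕ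
numFaces {n} Δ i =
  length (filter (λ F → Complex.face? Δ F ×-dec (∣ F ∣ ≟ suc i)) (allSubsets n))

-- (f₀, …, f_e) for e the dimension.
fVector : ∀ {n} → Complex n → (e : ℕ) → Vector ℕ (suc e)
fVector Δ e i = numFaces Δ (toℕ i)

-- v₀ ≤ v₁ ≤ … ≤ v_j ≥ v_{j+1} ≥ … ≥ v_e
Unimodal : ∀ {e} → Vector ℕ (suc e) → Set
Unimodal {e} v = Σ (Fin (suc e)) λ j →
  (∀ (i : Fin e) → toℕ i < toℕ j → v (inject₁ i) ≤ v (fsuc i)) ×
  (∀ (i : Fin e) → toℕ j ≤ toℕ i → v (fsuc i) ≤ v (inject₁ i))

{-# OPTIONS --safe #-}
-- Adding a leaf H with |H| = d, attached along G ∩ H with k = |G ∩ H|, creates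
-- C(d,i) − C(k,i) new faces of size i; the first facet is the case k = 0.
-- For fixed k ≤ d these differences increase in i ≥ 1 while 2i < d and decrease
-- once d ≤ 2i.  The turning point does not depend on k, so the sum over all
-- facets is unimodal as well.
module Submission where

open import Defs
open import Data.Bool.Base using (true; false)
open import Data.Fin.Base using (Fin; toℕ; fromℕ<; inject₁) renaming (suc to fsuc)
open import Data.Fin.Properties using (toℕ-inject₁; toℕ-fromℕ<)
open import Data.Fin.Subset using (Subset; inside; outside; _⊆_; _⊂_; _∩_; ∣_∣; ⊥)
open import Data.Fin.Subset.Properties using (_∈?_; _⊆?_; _⊂?_; anySubset?; p⊆q⇒∣p∣≤∣q∣; p⊂q⇒∣p∣<∣q∣; ⊆-refl; ⊆-trans; ⊆-antisym; ⊆-min; ∣⊥∣≡0; ∣p∣≤n; p∩q⊆p; p∩q⊆q; x∈p∩q⁺; out⊆; in⊆in; drop-∷-⊆)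
open import Data.List.Base using (List; []; _∷_; _++_; _∷ʳ_; map; filter; length; lookup; take)
open import Data.List.Membership.Propositional using (_∈_; find; lose)
open import Data.List.Membership.Propositional.Properties using (∈-lookup; ∈-++⁺ˡ; ∈-++⁻)
open import Data.List.Properties using (filter-++; filter-≐; filter-none; length-++; take-suc; take-all)
import Data.List.Relation.Unary.All as All
open import Data.List.Relation.Unary.AllPairs using (_∷_)
open import Data.List.Relation.Unary.Any using (Any; here; there; any?)
open import Data.List.Relation.Unary.Any.Properties using (++⁺ˡ; ++⁺ʳ; ++⁻)
open import Data.List.Relation.Unary.Unique.Propositional using (Unique)
open import Data.Nat.Base using (ℕ; zero; suc; _+_; _*_; _∸_; _≤_; _<_; _≤′_; ≤′-refl; ≤′-step; s≤s; z<s; ⌊_/2⌋; ⌈_/2⌉)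
open import Data.Nat.Combinatorics using (_C_; nC1≡n; nCk+nC[k+1]≡[n+1]C[k+1])
open import Data.Nat.Induction using (<-wellFounded)
open import Data.Nat.Properties
open import Data.Nat.Tactic.RingSolver using (solve-∀)
open import Data.Product.Base using (∃; _×_; _,_; proj₁; proj₂)
open import Data.Sum.Base using (_⊎_; inj₁; inj₂)
open import Data.Vec.Base as Vec using ([]; _∷_)
open import Function.Base using (_∘_)
open import Function.Bundles using (_⇔_; mk⇔; Equivalence)
open import Induction.WellFounded using (Acc; acc)
open import Level using (0ℓ)
open import Relation.Binary.PropositionalEquality using (_≡_; _≢_; refl; sym; trans; cong; cong₂; subst; module ≡-Reasoning)
open import Relation.Nullary using (¬_; yes; no; contradiction)
open import Relation.Nullary.Decidable using (_×-dec_; does; decidable-stable)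
open import Relation.Unary using (Pred; Decidable; _≐_; _∪_) renaming (_∩_ to _∩ₚ_)
open import Relation.Unary.Properties using (_∪?_; _∩?_)

-- Binomial coefficients

-- Subtraction-free form of `(k+1) C(n,k+1) = (n-k) C(n,k)`, which controls the ratio of
-- neighbouring binomial coefficients. Induction on `n` through Pascal's rule.
absorption : ∀ n k → suc k * (n C suc k) + k * (n C k) ≡ n * (n C k)
absorption zero    zero    = refl
absorption zero    (suc k) = cong₂ _+_ (*-zeroʳ k) (*-zeroʳ k)
absorption (suc n) zero    = begin
  (suc n C 1 + 0) + 0 ≡⟨ +-identityʳ _ ⟩
  suc n C 1 + 0       ≡⟨ +-identityʳ _ ⟩
  suc n C 1           ≡⟨ nC1≡n (suc n) ⟩
  suc n               ≡⟨ *-identityʳ (suc n) ⟨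
  suc n * 1           ∎
  where open ≡-Reasoning
absorption (suc n) (suc k)
  rewrite sym (nCk+nC[k+1]≡[n+1]C[k+1] n k) | sym (nCk+nC[k+1]≡[n+1]C[k+1] n (suc k)) = begin
  suc (suc k) * (b + c) + suc k * (a + b)
    -- The first group is the induction hypothesis at `suc k`, the second contains the one at `k`;
    -- the remaining `a + b` raises the factor `n` to `suc n`.
    ≡⟨ regroup k a b c ⟩
  (suc (suc k) * c + suc k * b) + ((suc k * b + k * a) + (a + b))
    ≡⟨ cong₂ (λ x y → x + (y + (a + b))) (absorption n (suc k)) (absorption n k) ⟩
  n * b + (n * a + (a + b))
    ≡⟨ collect n a b ⟩
  suc n * (a + b) ∎
  where
  open ≡-Reasoning
  a = n C k
  b = n C suc k
  c = n C suc (suc k)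
  regroup : ∀ k a b c → suc (suc k) * (b + c) + suc k * (a + b) ≡
    (suc (suc k) * c + suc k * b) + ((suc k * b + k * a) + (a + b))
  regroup = solve-∀
  collect : ∀ n a b → n * b + (n * a + (a + b)) ≡ suc n * (a + b)
  collect = solve-∀

-- By `absorption`, `C(n,k+1) / C(n,k) = (n-k)/(k+1)`, which is at least 1 once `2k+1 ≤ n`. Division
-- is avoided by adding `k C(n,k)` to both sides and cancelling `suc k`.
C-increasing : ∀ {n} k → k + suc k ≤ n → n C k ≤ n C suc k
C-increasing {n} k le = *-cancelˡ-≤ (suc k) (+-cancelʳ-≤ (k * (n C k)) _ _ (begin
  suc k * (n C k) + k * (n C k)     ≡⟨ *-distribʳ-+ (n C k) (suc k) k ⟨
  (suc k + k) * (n C k)             ≡⟨ cong (_* (n C k)) (+-comm (suc k) k) ⟩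
  (k + suc k) * (n C k)             ≤⟨ *-monoˡ-≤ (n C k) le ⟩
  n * (n C k)                       ≡⟨ absorption n k ⟨
  suc k * (n C suc k) + k * (n C k) ∎))
  where open ≤-Reasoning

C-decreasing : ∀ {n} k → n ≤ k + suc k → n C suc k ≤ n C k
C-decreasing {n} k le = *-cancelˡ-≤ (suc k) (+-cancelʳ-≤ (k * (n C k)) _ _ (begin
  suc k * (n C suc k) + k * (n C k) ≡⟨ absorption n k ⟩
  n * (n C k)                       ≤⟨ *-monoˡ-≤ (n C k) le ⟩
  (k + suc k) * (n C k)             ≡⟨ cong (_* (n C k)) (+-comm k (suc k)) ⟩
  (suc k + k) * (n C k)             ≡⟨ *-distribʳ-+ (n C k) (suc k) k ⟩
  suc k * (n C k) + k * (n C k)     ∎))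
  where open ≤-Reasoning

-- f d − f k ≤ g d − g k, stated without subtraction.
compare-increments : ∀ (f g : ℕ → ℕ) {k d} → k ≤′ d →
  (∀ l → k ≤ l → l < d → f (suc l) + g l ≤ g (suc l) + f l) →
  f d + g k ≤ g d + f k
compare-increments f g {k} ≤′-refl step = ≤-reflexive (+-comm (f k) (g k))
compare-increments f g {k} {suc d} (≤′-step k≤d) step =
  +-cancelʳ-≤ (f d + g d) _ _ (begin
  (f (suc d) + g k) + (f d + g d) ≡⟨ swap (f (suc d)) (g k) (f d) (g d) ⟩
  (f (suc d) + g d) + (f d + g k) ≤⟨ +-mono-≤ (step d (≤′⇒≤ k≤d) ≤-refl)
                                       (compare-increments f g k≤d λ l k≤l l<d → step l k≤l (m<n⇒m<1+n l<d)) ⟩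
  (g (suc d) + f d) + (g d + f k) ≡⟨ swap′ (g (suc d)) (f d) (g d) (f k) ⟩
  (g (suc d) + f k) + (f d + g d) ∎)
  where
  open ≤-Reasoning
  swap : ∀ a b c d → (a + b) + (c + d) ≡ (a + d) + (c + b)
  swap = solve-∀
  swap′ : ∀ a b c d → (a + b) + (c + d) ≡ (a + d) + (b + c)
  swap′ = solve-∀

-- If `k ≤ 2i+3`, the row `k` already falls from `i+1` to `i+2` while the row `d` rises. Otherwise
-- `C(l,i+2) - C(l,i+1)` grows with `l` from `k` to `d`: by Pascal's rule its increment is
-- `C(l,i+1) - C(l,i)`, nonnegative because `l ≥ 2i+1`.
C-difference-increasing : ∀ {k d} i → k ≤ d → suc i + suc (suc i) ≤ d →
  d C suc i + k C suc (suc i) ≤ d C suc (suc i) + k C suc i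
C-difference-increasing {k} {d} i k≤d le with ≤-total k (suc i + suc (suc i))
... | inj₁ k≤2i = +-mono-≤ (C-increasing (suc i) le) (C-decreasing (suc i) k≤2i)
... | inj₂ 2i≤k = compare-increments (_C suc i) (_C suc (suc i)) (≤⇒≤′ k≤d) step
  where
  step : ∀ l → k ≤ l → l < d → suc l C suc i + l C suc (suc i) ≤ suc l C suc (suc i) + l C suc i
  step l k≤l _
    rewrite sym (nCk+nC[k+1]≡[n+1]C[k+1] l i) | sym (nCk+nC[k+1]≡[n+1]C[k+1] l (suc i)) = begin
    (a + b) + c ≡⟨ shift a b c ⟩
    (b + c) + a ≤⟨ +-monoʳ-≤ (b + c) (C-increasing i i+1+i≤l) ⟩
    (b + c) + b ∎
    where
    open ≤-Reasoning
    a = l C i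
    b = l C suc i
    c = l C suc (suc i)
    shift : ∀ a b c → (a + b) + c ≡ (b + c) + a
    shift = solve-∀
    i+1+i≤l : i + suc i ≤ l
    i+1+i≤l = ≤-trans (+-mono-≤ (n≤1+n i) (n≤1+n (suc i))) (≤-trans 2i≤k k≤l)

-- One case suffices: every `l < d` satisfies `l ≤ 2i+1`, so the increments `C(l,i+1) - C(l,i)` are
-- nowhere positive between `k` and `d`.
C-difference-decreasing : ∀ {k d} i → k ≤ d → d ≤ suc i + suc i →
  d C suc (suc i) + k C suc i ≤ d C suc i + k C suc (suc i)
C-difference-decreasing {k} {d} i k≤d le = compare-increments (_C suc (suc i)) (_C suc i) (≤⇒≤′ k≤d) step
  where
  step : ∀ l → k ≤ l → l < d → suc l C suc (suc i) + l C suc i ≤ suc l C suc i + l C suc (suc i)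
  step l _ l<d
    rewrite sym (nCk+nC[k+1]≡[n+1]C[k+1] l i) | sym (nCk+nC[k+1]≡[n+1]C[k+1] l (suc i)) = begin
    (b + c) + b ≤⟨ +-monoʳ-≤ (b + c) (C-decreasing i (≤-pred (≤-trans l<d le))) ⟩
    (b + c) + a ≡⟨ shift a b c ⟨
    (a + b) + c ∎
    where
    open ≤-Reasoning
    a = l C i
    b = l C suc i
    c = l C suc (suc i)
    shift : ∀ a b c → (a + b) + c ≡ (b + c) + a
    shift = solve-∀

-- Passing from x, y to x′ = x + (a − c), y′ = y + (b − d) with a − c ≤ b − d.
transfer : ∀ {x y x′ y′ a b c d} → x′ + c ≡ x + a → y′ + d ≡ y + b →
  x ≤ y → a + d ≤ b + c → x′ ≤ y′
transfer {x} {y} {x′} {y′} {a} {b} {c} {d} ex ey x≤y le = +-cancelʳ-≤ (c + d) _ _ (begin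
  x′ + (c + d) ≡⟨ +-assoc x′ c d ⟨
  (x′ + c) + d ≡⟨ cong (_+ d) ex ⟩
  (x + a) + d  ≡⟨ +-assoc x a d ⟩
  x + (a + d)  ≤⟨ +-mono-≤ x≤y le ⟩
  y + (b + c)  ≡⟨ +-assoc y b c ⟨
  (y + b) + c  ≡⟨ cong (_+ c) ey ⟨
  (y′ + d) + c ≡⟨ +-assoc y′ d c ⟩
  y′ + (d + c) ≡⟨ cong (y′ +_) (+-comm d c) ⟩
  y′ + (c + d) ∎)
  where open ≤-Reasoning

-- Counting

module _ {A : Set} where

  count : {P : Pred A 0ℓ} → Decidable P → List A → ℕ
  count P? xs = length (filter P? xs)

  count-cong : {P Q : Pred A 0ℓ} (P? : Decidable P) (Q? : Decidable Q) → P ≐ Q → ∀ xs → count P? xs ≡ count Q? xs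
  count-cong P? Q? P≐Q xs = cong length (filter-≐ P? Q? P≐Q xs)

  count-none : {P : Pred A 0ℓ} (P? : Decidable P) → (∀ x → ¬ P x) → ∀ xs → count P? xs ≡ 0
  count-none P? ¬P xs = cong length (filter-none P? (All.universal ¬P xs))

  count-++ : {P : Pred A 0ℓ} (P? : Decidable P) → ∀ xs ys → count P? (xs ++ ys) ≡ count P? xs + count P? ys
  count-++ P? xs ys = trans (cong length (filter-++ P? xs ys)) (length-++ (filter P? xs))

  count-∪-∩ : {P Q : Pred A 0ℓ} (P? : Decidable P) (Q? : Decidable Q) → ∀ xs →
    count (P? ∪? Q?) xs + count (P? ∩? Q?) xs ≡ count P? xs + count Q? xs
  count-∪-∩ P? Q? [] = refl
  count-∪-∩ P? Q? (x ∷ xs) with ih ← count-∪-∩ P? Q? xs | does (P? x) | does (Q? x)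
  ... | true  | true  = cong suc (trans (+-suc _ _) (trans (cong suc ih) (sym (+-suc _ _))))
  ... | true  | false = cong suc ih
  ... | false | true  = trans (cong suc ih) (sym (+-suc _ _))
  ... | false | false = ih

count-map : {A B : Set} {P : Pred B 0ℓ} (P? : Decidable P) (f : A → B) → ∀ xs → count P? (map f xs) ≡ count (P? ∘ f) xs
count-map P? f [] = refl
count-map P? f (x ∷ xs) with ih ← count-map P? f xs | does (P? (f x))
... | true  = cong suc ih
... | false = ih

inFace? : ∀ {n} (H : Subset n) i → Decidable (λ F → F ⊆ H × ∣ F ∣ ≡ i)
inFace? H i F = (F ⊆? H) ×-dec (∣ F ∣ ≟ i)

⊆-outside-∷ : ∀ {n} y (H : Subset n) i →
  (λ F → outside ∷ F ⊆ y ∷ H × ∣ outside ∷ F ∣ ≡ i) ≐ (λ F → F ⊆ H × ∣ F ∣ ≡ i)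
⊆-outside-∷ y H i = (λ F⊆H → drop-∷-⊆ (proj₁ F⊆H) , proj₂ F⊆H) , (λ F⊆H → out⊆ (proj₁ F⊆H) , proj₂ F⊆H)

⊆-inside-∷ : ∀ {n} (H : Subset n) i →
  (λ F → inside ∷ F ⊆ inside ∷ H × ∣ inside ∷ F ∣ ≡ suc i) ≐ (λ F → F ⊆ H × ∣ F ∣ ≡ i)
⊆-inside-∷ H i = (λ F⊆H → drop-∷-⊆ (proj₁ F⊆H) , suc-injective (proj₂ F⊆H)) ,
                   (λ F⊆H → in⊆in (proj₁ F⊆H) , cong suc (proj₂ F⊆H))

inside⊈outside : ∀ {n} {F H : Subset n} → ¬ (inside ∷ F ⊆ outside ∷ H)
inside⊈outside F⊆H with () ← F⊆H Vec.here

-- Splitting on whether the first vertex is chosen reproduces Pascal's rule when `H` contains that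
-- vertex; when it does not, the second half contributes nothing.
count-subsets : ∀ {n} (H : Subset n) i → count (inFace? H i) (allSubsets n) ≡ ∣ H ∣ C i
count-subsets {zero}  []      zero    = refl
count-subsets {zero}  []      (suc i) = refl
count-subsets {suc n} (y ∷ H) i = begin
  count (inFace? (y ∷ H) i) (allSubsets (suc n))
    ≡⟨ count-++ (inFace? (y ∷ H) i) (map (outside ∷_) (allSubsets n)) _ ⟩
  count (inFace? (y ∷ H) i) (map (outside ∷_) (allSubsets n)) +
  count (inFace? (y ∷ H) i) (map (inside ∷_) (allSubsets n))
    ≡⟨ cong₂ _+_ (count-map (inFace? (y ∷ H) i) (outside ∷_) (allSubsets n))
                 (count-map (inFace? (y ∷ H) i) (inside ∷_) (allSubsets n)) ⟩
  count (λ F → inFace? (y ∷ H) i (outside ∷ F)) (allSubsets n) + with-inside y i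
    ≡⟨ cong (_+ with-inside y i) (count-cong _ (inFace? H i) (⊆-outside-∷ y H i) (allSubsets n)) ⟩
  count (inFace? H i) (allSubsets n) + with-inside y i
    ≡⟨ cong (_+ with-inside y i) (count-subsets H i) ⟩
  ∣ H ∣ C i + with-inside y i
    ≡⟨ pascal y i ⟩
  ∣ y ∷ H ∣ C i ∎
  where
  open ≡-Reasoning
  with-inside : ∀ y i → ℕ
  with-inside y i = count (λ F → inFace? (y ∷ H) i (inside ∷ F)) (allSubsets n)
  pascal : ∀ y i → ∣ H ∣ C i + with-inside y i ≡ ∣ y ∷ H ∣ C i
  pascal outside i = trans
    (cong (∣ H ∣ C i +_)
      (count-none (inFace? (outside ∷ H) i ∘ (inside ∷_))
        (λ F F⊆H → inside⊈outside {F = F} {H} (proj₁ F⊆H)) (allSubsets n)))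
    (+-identityʳ _)
  pascal inside zero = trans (cong (∣ H ∣ C 0 +_) (count-none _ (λ F → λ { (_ , ()) }) (allSubsets n))) (+-identityʳ _)
  pascal inside (suc i) = begin
    ∣ H ∣ C suc i + with-inside inside (suc i)
      ≡⟨ cong (∣ H ∣ C suc i +_) (count-cong _ (inFace? H i) (⊆-inside-∷ H i) (allSubsets n)) ⟩
    ∣ H ∣ C suc i + count (inFace? H i) (allSubsets n)
      ≡⟨ cong (∣ H ∣ C suc i +_) (count-subsets H i) ⟩
    ∣ H ∣ C suc i + ∣ H ∣ C i
      ≡⟨ +-comm (∣ H ∣ C suc i) (∣ H ∣ C i) ⟩
    ∣ H ∣ C i + ∣ H ∣ C suc i
      ≡⟨ nCk+nC[k+1]≡[n+1]C[k+1] ∣ H ∣ i ⟩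
    suc ∣ H ∣ C suc i ∎

∈-take⁻ : ∀ {A : Set} {x : A} t xs → x ∈ take t xs → x ∈ xs
∈-take⁻ (suc t) (_ ∷ xs) (here e)  = here e
∈-take⁻ (suc t) (_ ∷ xs) (there p) = there (∈-take⁻ t xs p)

-- The leaf condition only restricts facets different from the leaf, so earlier facets must be known
-- to differ from the current one.
lookup-fresh : ∀ {A : Set} {xs : List A} → Unique xs → ∀ j {x} → x ∈ take (toℕ j) xs → x ≢ lookup xs j
lookup-fresh (x∉ ∷ _) (fsuc j) (here refl) = All.lookup x∉ (∈-lookup j)
lookup-fresh (_ ∷ u)  (fsuc j) (there p)   = lookup-fresh u j p

⊆∧⊄⇒≡ : ∀ {n} {F G : Subset n} → F ⊆ G → ¬ F ⊂ G → F ≡ G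
⊆∧⊄⇒≡ {F = F} F⊆G F⊄G = ⊆-antisym F⊆G λ {x} x∈G →
  decidable-stable (x ∈? F) λ x∉F → F⊄G (F⊆G , x , x∈G , x∉F)

-- Faces covered by a list of simplices

module _ {n : ℕ} where

  covered? : ∀ (Fs : List (Subset n)) i → Decidable (λ F → Any (F ⊆_) Fs × ∣ F ∣ ≡ i)
  covered? Fs i F = any? (F ⊆?_) Fs ×-dec (∣ F ∣ ≟ i)

  -- Indexed by cardinality rather than dimension, and dependent on the list alone, so that the
  -- induction over prefixes can count without referring to a complex.
  numCovered : List (Subset n) → ℕ → ℕ
  numCovered Fs i = count (covered? Fs i) (allSubsets n)

  -- The faces of H already covered by Fs form, apart from ∅, a single simplex.
  Attaches : List (Subset n) → Subset n → Set
  Attaches Fs H = ∃ λ E → E ⊆ H × (∀ F → 0 < ∣ F ∣ → (Any (F ⊆_) Fs × F ⊆ H) ⇔ F ⊆ E)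

  -- Inclusion-exclusion for the sets covered by `Fs` and the subsets of `H`: their common members
  -- of positive size are exactly the subsets of `E`.
  numCovered-∷ʳ : ∀ Fs H (att : Attaches Fs H) i →
    numCovered (Fs ∷ʳ H) (suc i) + ∣ proj₁ att ∣ C suc i ≡ numCovered Fs (suc i) + ∣ H ∣ C suc i
  numCovered-∷ʳ Fs H (E , _ , iff) i = begin
    numCovered (Fs ∷ʳ H) (suc i) + ∣ E ∣ C suc i
      ≡⟨ cong (numCovered (Fs ∷ʳ H) (suc i) +_) (count-subsets E (suc i)) ⟨
    numCovered (Fs ∷ʳ H) (suc i) + count (inFace? E (suc i)) (allSubsets n)
      ≡⟨ cong₂ _+_ (count-cong _ (P? ∪? Q?) union (allSubsets n))
                   (count-cong _ (P? ∩? Q?) intersection (allSubsets n)) ⟩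
    count (P? ∪? Q?) (allSubsets n) + count (P? ∩? Q?) (allSubsets n)
      ≡⟨ count-∪-∩ P? Q? (allSubsets n) ⟩
    numCovered Fs (suc i) + count Q? (allSubsets n)
      ≡⟨ cong (numCovered Fs (suc i) +_) (count-subsets H (suc i)) ⟩
    numCovered Fs (suc i) + ∣ H ∣ C suc i ∎
    where
    open ≡-Reasoning
    P Q : Pred (Subset n) 0ℓ
    P F = Any (F ⊆_) Fs × ∣ F ∣ ≡ suc i
    Q F = F ⊆ H × ∣ F ∣ ≡ suc i
    P? : Decidable P
    P? = covered? Fs (suc i)
    Q? : Decidable Q
    Q? = inFace? H (suc i)
    split : ∀ {F} → Any (F ⊆_) (Fs ∷ʳ H) × ∣ F ∣ ≡ suc i → P F ⊎ Q F
    split (c , e) with ++⁻ Fs c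
    ... | inj₁ c′         = inj₁ (c′ , e)
    ... | inj₂ (here F⊆H) = inj₂ (F⊆H , e)
    merge : ∀ {F} → P F ⊎ Q F → Any (F ⊆_) (Fs ∷ʳ H) × ∣ F ∣ ≡ suc i
    merge (inj₁ (c , e))   = ++⁺ˡ c , e
    merge (inj₂ (F⊆H , e)) = ++⁺ʳ Fs (here F⊆H) , e
    union : (λ F → Any (F ⊆_) (Fs ∷ʳ H) × ∣ F ∣ ≡ suc i) ≐ (P ∪ Q)
    union = split , merge
    positive : ∀ {F : Subset n} → ∣ F ∣ ≡ suc i → 0 < ∣ F ∣
    positive e = subst (0 <_) (sym e) z<s
    intersection : (λ F → F ⊆ E × ∣ F ∣ ≡ suc i) ≐ (P ∩ₚ Q)
    intersection = fwd , bwd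
      where
      fwd : ∀ {F} → F ⊆ E × ∣ F ∣ ≡ suc i → P F × Q F
      fwd {F} (F⊆E , e) with c , F⊆H ← Equivalence.from (iff F (positive {F} e)) F⊆E = (c , e) , (F⊆H , e)
      bwd : ∀ {F} → P F × Q F → F ⊆ E × ∣ F ∣ ≡ suc i
      bwd {F} ((c , e) , (F⊆H , _)) = Equivalence.to (iff F (positive {F} e)) (c , F⊆H) , e

  -- The two ranges, `2i+3 ≤ d` and `d ≤ 2i+2`, leave no gap. The threshold depends only on `d`, so
  -- the property can be carried from one prefix to the next.
  UnimodalAround : ℕ → List (Subset n) → Set
  UnimodalAround d Fs = ∀ i →
    (suc i + suc (suc i) ≤ d → numCovered Fs (suc i) ≤ numCovered Fs (suc (suc i))) ×
    (d ≤ suc i + suc i → numCovered Fs (suc (suc i)) ≤ numCovered Fs (suc i))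

  unimodalAround-[] : ∀ d → UnimodalAround d []
  unimodalAround-[] d i =
    (λ _ → ≤-reflexive (trans (none i) (sym (none (suc i))))) ,
    (λ _ → ≤-reflexive (trans (none (suc i)) (sym (none i))))
    where
    none : ∀ i → numCovered [] (suc i) ≡ 0
    none i = count-none (covered? [] (suc i)) (λ _ → λ { (() , _) }) (allSubsets n)

  -- The count at size `s` grows by `C(d,s) - C(k,s)` with `k = ∣ E ∣`, and on each range these
  -- growths are ordered in the same direction as the old counts.
  unimodalAround-∷ʳ : ∀ {d} Fs H → Attaches Fs H → ∣ H ∣ ≡ d → UnimodalAround d Fs → UnimodalAround d (Fs ∷ʳ H)
  unimodalAround-∷ʳ Fs H att@(E , E⊆H , _) refl uni i =
    (λ le → transfer (numCovered-∷ʳ Fs H att i) (numCovered-∷ʳ Fs H att (suc i))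
              (proj₁ (uni i) le) (C-difference-increasing i ∣E∣≤∣H∣ le)) ,
    (λ le → transfer (numCovered-∷ʳ Fs H att (suc i)) (numCovered-∷ʳ Fs H att i)
              (proj₂ (uni i) le) (C-difference-decreasing i ∣E∣≤∣H∣ le))
    where
    ∣E∣≤∣H∣ : ∣ E ∣ ≤ ∣ H ∣
    ∣E∣≤∣H∣ = p⊆q⇒∣p∣≤∣q∣ E⊆H

  -- Only the empty set lies in `⊥`, and positivity of the size excludes it. The first facet thus
  -- follows the same counting rule as the later ones.
  attaches-[] : ∀ H → Attaches [] H
  attaches-[] H = ⊥ , ⊆-min H , λ F 0<∣F∣ → mk⇔ (λ { (() , _) }) (nonempty⊈⊥ F 0<∣F∣)
    where
    nonempty⊈⊥ : ∀ F → 0 < ∣ F ∣ → F ⊆ ⊥ → Any (F ⊆_) [] × F ⊆ H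
    nonempty⊈⊥ F 0<∣F∣ F⊆⊥ = contradiction (subst (0 <_) (∣⊥∣≡0 n) (≤-trans 0<∣F∣ (p⊆q⇒∣p∣≤∣q∣ F⊆⊥))) λ ()

  -- Facets and leaves of a complex

  module _ (Δ : Complex n) where
    open Complex Δ

    -- Replace a face by a strictly larger one while a search through all subsets finds any; the
    -- codimension `n ∸ ∣ F ∣` drops each time.
    face⊆facet : ∀ F → Face F → ∃ λ H → Facet Δ H × F ⊆ H
    face⊆facet F = go F (<-wellFounded (n ∸ ∣ F ∣))
      where
      go : ∀ F → Acc _<_ (n ∸ ∣ F ∣) → Face F → ∃ λ H → Facet Δ H × F ⊆ H
      go F (acc rs) face with anySubset? (λ G → face? G ×-dec (F ⊂? G))
      ... | no none = F , (face , λ G faceG F⊆G → ⊆∧⊄⇒≡ F⊆G λ F⊂G → none (G , faceG , F⊂G)) , ⊆-refl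
      ... | yes (G , faceG , F⊂G)
        with H , facet , G⊆H ← go G (rs (∸-monoʳ-< (p⊂q⇒∣p∣<∣q∣ F⊂G) (∣p∣≤n G))) faceG
        = H , facet , ⊆-trans (proj₁ F⊂G) G⊆H

    facet-subcomplex : ∀ {Fs H} → H ∈ Fs → Facet Δ H → Facet (subcomplex Δ Fs) H
    facet-subcomplex H∈Fs (face , maximal) = (face , lose H∈Fs ⊆-refl) , λ G faceG → maximal G (proj₁ faceG)

    -- A facet of the subcomplex lies in some generator, which is itself a face there, so maximality
    -- makes the two equal.
    facet-subcomplex-∈ : ∀ {Fs G} → (∀ {H} → H ∈ Fs → Face H) → Facet (subcomplex Δ Fs) G → G ∈ Fs
    facet-subcomplex-∈ {Fs} faces ((_ , c) , maximal) with H , H∈Fs , G⊆H ← find c =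
      subst (_∈ Fs) (sym (maximal H (faces H∈Fs , lose H∈Fs ⊆-refl) G⊆H)) H∈Fs

    -- The simplex of attachment is `G ∩ H`, with `G` the facet witnessing the leaf: a subset of `H`
    -- covered by `K` lies in `K ∩ H`, hence in `G ∩ H`. The converse needs `G` to occur before `H`.
    leaf-attaches : ∀ {Fs H} → (∀ {K} → K ∈ Fs ∷ʳ H → Facet Δ K) → (∀ {K} → K ∈ Fs → K ≢ H) →
      Leaf (subcomplex Δ (Fs ∷ʳ H)) H → Attaches Fs H
    leaf-attaches {Fs} {H} facets fresh (_ , G , facetG , G≢H , absorbs) =
      G ∩ H , p∩q⊆q G H , λ F _ → mk⇔ (to F) (from F)
      where
      G∈Fs : G ∈ Fs
      G∈Fs with ∈-++⁻ Fs (facet-subcomplex-∈ (proj₁ ∘ facets) facetG)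
      ... | inj₁ G∈Fs       = G∈Fs
      ... | inj₂ (here G≡H) = contradiction G≡H G≢H
      to : ∀ F → Any (F ⊆_) Fs × F ⊆ H → F ⊆ G ∩ H
      to F (c , F⊆H) x∈F with K , K∈Fs , F⊆K ← find c =
        absorbs K (facet-subcomplex (∈-++⁺ˡ K∈Fs) (facets (∈-++⁺ˡ K∈Fs))) (fresh K∈Fs)
          (x∈p∩q⁺ (F⊆K x∈F , F⊆H x∈F))
      from : ∀ F → F ⊆ G ∩ H → Any (F ⊆_) Fs × F ⊆ H
      from F F⊆ = lose G∈Fs (⊆-trans F⊆ (p∩q⊆p G H)) , ⊆-trans F⊆ (p∩q⊆q G H)

    module _ {d} (uniform : ∀ {H} → Facet Δ H → ∣ H ∣ ≡ d) {Hs} (ordering : FacetOrdering Δ Hs)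
             (leaves : ∀ (j : Fin (length Hs)) → 0 < toℕ j →
                Leaf (subcomplex Δ (take (suc (toℕ j)) Hs)) (lookup Hs j)) where

      ∈⇒facet : ∀ {H} → H ∈ Hs → Facet Δ H
      ∈⇒facet {H} = Equivalence.to (proj₂ ordering H)

      prefix-attaches : ∀ j → Attaches (take (toℕ j) Hs) (lookup Hs j)
      prefix-attaches j with toℕ j in eq
      -- The leaf hypothesis begins at position 1; at position 0 the prefix is empty.
      ... | zero  = attaches-[] (lookup Hs j)
      ... | suc t = subst (λ t → Attaches (take t Hs) (lookup Hs j)) eq
        (leaf-attaches (∈⇒facet ∘ ∈-take⁻ (suc (toℕ j)) Hs ∘ subst (_ ∈_) (sym (take-suc Hs j)))
          (lookup-fresh (proj₁ ordering) j)
          (subst (λ Fs → Leaf (subcomplex Δ Fs) (lookup Hs j)) (take-suc Hs j)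
            (leaves j (subst (0 <_) (sym eq) z<s))))

      prefix-unimodal : ∀ t → t ≤ length Hs → UnimodalAround d (take t Hs)
      prefix-unimodal zero    _  = unimodalAround-[] d
      -- The facet added is the one at position `j`, where `toℕ j` equals `t`; `take-suc` splits it
      -- off the longer prefix.
      prefix-unimodal (suc t) le = subst (λ t → UnimodalAround d (take (suc t) Hs)) (toℕ-fromℕ< le)
        (subst (UnimodalAround d) (sym (take-suc Hs j))
          (unimodalAround-∷ʳ _ _ (prefix-attaches j) (uniform (∈⇒facet (∈-lookup j)))
            (subst (λ t → UnimodalAround d (take t Hs)) (sym (toℕ-fromℕ< le)) (prefix-unimodal t (<⇒≤ le)))))
        where
        j : Fin (length Hs)
        j = fromℕ< le

      unimodal : UnimodalAround d Hs
      unimodal = subst (UnimodalAround d) (take-all (length Hs) Hs ≤-refl) (prefix-unimodal (length Hs) ≤-refl)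

      -- Every face lies in a facet and `Hs` lists all facets. The shift arises because `numFaces`
      -- is indexed by dimension.
      numFaces≡numCovered : ∀ i → numFaces Δ i ≡ numCovered Hs (suc i)
      numFaces≡numCovered i = count-cong _ (covered? Hs (suc i)) (to , from) (allSubsets n)
        where
        to : ∀ {F} → Face F × ∣ F ∣ ≡ suc i → Any (F ⊆_) Hs × ∣ F ∣ ≡ suc i
        to {F} (face , e) with H , facet , F⊆H ← face⊆facet F face =
          lose (Equivalence.from (proj₂ ordering H) facet) F⊆H , e
        from : ∀ {F} → Any (F ⊆_) Hs × ∣ F ∣ ≡ suc i → Face F × ∣ F ∣ ≡ suc i
        from (c , e) with H , H∈Hs , F⊆H ← find c = downClosed (proj₁ (∈⇒facet H∈Hs)) F⊆H , e

  -- A face of the top dimension extends to a facet, which the dimension bound forces to have size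
  -- `suc e`; purity passes this size to all facets.
  facet-size : ∀ (Δ : Complex n) {e} → HasDimension Δ e → Pure Δ → ∀ {H} → Facet Δ H → ∣ H ∣ ≡ suc e
  facet-size Δ ((F , face , ∣F∣≡) , bound) pure {H} facetH
    with K , facetK , F⊆K ← face⊆facet Δ F face =
    trans (pure H K facetH facetK) (≤-antisym (bound K (proj₁ facetK)) (subst (_≤ ∣ K ∣) ∣F∣≡ (p⊆q⇒∣p∣≤∣q∣ F⊆K)))

-- Location of the mode

m<⌊n/2⌋⇒1+m+1+m≤n : ∀ {i e} → i < ⌊ e /2⌋ → suc i + suc i ≤ e
m<⌊n/2⌋⇒1+m+1+m≤n {i} {e} lt = begin
  suc i + suc i         ≤⟨ +-mono-≤ lt (≤-trans lt (⌊n/2⌋≤⌈n/2⌉ e)) ⟩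
  ⌊ e /2⌋ + ⌈ e /2⌉     ≡⟨ ⌊n/2⌋+⌈n/2⌉≡n e ⟩
  e                     ∎
  where open ≤-Reasoning

-- Uses that the upper half exceeds the lower half by at most 1.
⌊n/2⌋≤m⇒n≤m+1+m : ∀ {i} e → ⌊ e /2⌋ ≤ i → e ≤ i + suc i
⌊n/2⌋≤m⇒n≤m+1+m {i} e le = begin
  e                     ≡⟨ ⌊n/2⌋+⌈n/2⌉≡n e ⟨
  ⌊ e /2⌋ + ⌈ e /2⌉     ≤⟨ +-mono-≤ le (≤-trans (⌊n/2⌋-mono (n≤1+n (suc e))) (s≤s le)) ⟩
  i + suc i             ∎
  where open ≤-Reasoning

theorem3p2 : (n : ℕ) (Δ : SimplicialComplex n) (d-1 : ℕ) →
    let open SimplicialComplex Δ using (complex) in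
    HasDimension complex d-1 →
    Pure complex →
    QuasiForest complex →
    Unimodal (fVector complex d-1)
theorem3p2 n Δ e dim pure (Hs , ordering , leaves) = mode , increasing , decreasing
  where
  open SimplicialComplex Δ using (complex)
  size : ∀ {H} → Facet complex H → ∣ H ∣ ≡ suc e
  size = facet-size complex dim pure
  faces : ∀ i → numFaces complex i ≡ numCovered Hs (suc i)
  faces = numFaces≡numCovered complex size ordering leaves
  uni : UnimodalAround (suc e) Hs
  uni = unimodal complex size ordering leaves
  -- Faces of dimension `i` have size `i+1`, and `d = e+1`. The rising condition `2i+3 ≤ d`
  -- therefore reads `i+1 ≤ e/2`, that is `i < ⌊ e /2⌋`.
  mode : Fin (suc e)
  mode = fromℕ< (s≤s (⌊n/2⌋≤n e))
  mode≡ : toℕ mode ≡ ⌊ e /2⌋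
  mode≡ = toℕ-fromℕ< (s≤s (⌊n/2⌋≤n e))
  increasing : ∀ (i : Fin e) → toℕ i < toℕ mode →
    fVector complex e (inject₁ i) ≤ fVector complex e (fsuc i)
  increasing i lt rewrite toℕ-inject₁ i | faces (toℕ i) | faces (suc (toℕ i)) =
    proj₁ (uni (toℕ i)) (subst (_≤ suc e) (sym (+-suc (suc (toℕ i)) (suc (toℕ i))))
      (s≤s (m<⌊n/2⌋⇒1+m+1+m≤n (subst (toℕ i <_) mode≡ lt))))
  decreasing : ∀ (i : Fin e) → toℕ mode ≤ toℕ i →
    fVector complex e (fsuc i) ≤ fVector complex e (inject₁ i)
  decreasing i le rewrite toℕ-inject₁ i | faces (toℕ i) | faces (suc (toℕ i)) =
    proj₂ (uni (toℕ i)) (s≤s (⌊n/2⌋≤m⇒n≤m+1+m e (subst (_≤ toℕ i) mode≡ le)))
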